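{- For every fixed integer $k\ge 3$, there is a constant $c_k>0$ such that $f(s,k)\ge g(k)+\frac{c_k}{s}$ for all $s\ge 1$; that is, $f(s,k)\ge g(k)+\Theta(\frac1s)$.
   Context: Let $\Sigma_s=\{0,\ldots,s-1\}$ with its natural order. For a word $w$ (sequence), subwords are subsequences counted by position sets, monotone if non-decreasing or non-increasing; $m(k,w)$ is the number of monotone $k$-subwords. $f(s,k,n)=\min_{w\in(\Sigma_s)^n}m(k,w)/\binom nk$, $f(s,k)=\lim_{n\to\infty}f(s,k,n)$. $g(k,n)$ is the minimum over permutations $\pi$ of $[n]$ of $m(k,\pi)/\binom nk$, and $g(k)=\lim_{n\to\infty}g(k,n)$. -}

module Defs where

open import Data.Nat using (ℕ; zero; suc; _≤ᵇ_; _≡ᵇ_)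
open import Data.Nat.Combinatorics using (_C_)
open import Data.Bool using (Bool; true; false; _∧_; _∨_; not)
open import Data.Fin using (Fin; toℕ)
open import Data.List using (List; []; _∷_; map; _++_; concatMap; allFin; length; filterᵇ; [_])
open import Data.Integer using (+_)
open import Data.Rational using (ℚ; _/_; 0ℚ; _⊓_)

allWords : (s n : ℕ) → List (List (Fin s))
allWords s zero = [ [] ]
allWords s (suc n) = concatMap (λ a → map (a ∷_) (allWords s n)) (allFin s)

-- choose k xs : all k-subwords of xs, one for each set of k positions
-- (so equal subsequences at different positions are counted separately).
choose : {A : Set} → ℕ → List A → List (List A)
choose zero _ = [ [] ]
choose (suc k) [] = []
choose (suc k) (x ∷ xs) = map (x ∷_) (choose k xs) ++ choose (suc k) xs

nondecreasing : List ℕ → Bool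
nondecreasing [] = true
nondecreasing (x ∷ []) = true
nondecreasing (x ∷ y ∷ ys) = (x ≤ᵇ y) ∧ nondecreasing (y ∷ ys)

nonincreasing : List ℕ → Bool
nonincreasing [] = true
nonincreasing (x ∷ []) = true
nonincreasing (x ∷ y ∷ ys) = (y ≤ᵇ x) ∧ nonincreasing (y ∷ ys)

monotone : List ℕ → Bool
monotone xs = nondecreasing xs ∨ nonincreasing xs

mono : ℕ → List ℕ → ℕ
mono k w = length (filterᵇ monotone (choose k w))

-- a / b as a rational (junk value 0 when b = 0)
ratio : ℕ → ℕ → ℚ
ratio a zero = 0ℚ
ratio a (suc b) = (+ a) / suc b

-- 1/s (junk value 0 when s = 0)
inv : ℕ → ℚ
inv zero = 0ℚ
inv (suc s) = (+ 1) / suc s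

-- minimum of a list of rationals (junk value 0 for the empty list)
minList : List ℚ → ℚ
minList [] = 0ℚ
minList (x ∷ []) = x
minList (x ∷ y ∷ ys) = x ⊓ minList (y ∷ ys)

toℕs : {s : ℕ} → List (Fin s) → List ℕ
toℕs = map toℕ

f : ℕ → ℕ → ℕ → ℚ
f s k n = minList (map (λ w → ratio (mono k (toℕs w)) (n C k)) (allWords s n))

notIn : ℕ → List ℕ → Bool
notIn x [] = true
notIn x (y ∷ ys) = not (x ≡ᵇ y) ∧ notIn x ys

distinct : List ℕ → Bool
distinct [] = true
distinct (x ∷ xs) = notIn x xs ∧ distinct xs

-- permutations of [n] (as words of length n over {0,…,n-1} with distinct letters,
-- i.e. in one-line notation, shifted by one)
perms : ℕ → List (List ℕ)
perms n = filterᵇ distinct (map toℕs (allWords n n))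

g : ℕ → ℕ → ℚ
g k n = minList (map (λ π → ratio (mono k π) (n C k)) (perms n))

{-# OPTIONS --safe #-}

-- Call a k-subword tied if it has the form x x v with x v monotone (hence it is monotone).
-- Cut a word of length m = 2sM, M = 4^(k-1), into M blocks of length 2s.  In each block at least s
-- positions carry a letter that recurs later in the block.  By Erdős–Szekeres every choice of one such
-- position per block contains a monotone (k-1)-subword, whose first letter can be doubled inside its block;
-- counting choices gives at least s^(k-1) tied k-subwords.  Averaging over the subwords of length m, a word
-- of length n ≥ m has at least C(n,k) / (s (2M)^k) tied k-subwords.
--
-- Turn the word into a permutation by breaking ties with keys: each position independently receives
-- either a low key, decreasing along the word, or a high key, increasing along the word.  No new monotone
-- subwords arise, and for k ≥ 3 each tied one is destroyed by at least one of the 2^k key patterns on it.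
-- Hence some choice of keys destroys a fraction 2^(-k) of them, and c = (4M)^(-k) works.
module Submission where

open import Defs
open import Data.Nat as ℕ using (ℕ; zero; suc; _≤_; z≤n; s≤s; NonZero; >-nonZero; ≢-nonZero⁻¹)
import Data.Nat.Properties as ℕ
open import Data.Nat.Combinatorics using (_C_; nCk+nC[k+1]≡[n+1]C[k+1])
open import Data.Nat.Tactic.RingSolver using (solve-∀)
open import Data.Bool using (Bool; true; false; T; T?; _∧_; _∨_; not; if_then_else_)
open import Data.Bool.Properties using (T-≡; ∨-zeroʳ; ∧-conicalˡ; ∧-conicalʳ)
open import Data.Fin using (Fin; zero; suc; fromℕ<; toℕ)
open import Data.Fin.Properties using (injective⇒≤; fromℕ<-injective; toℕ-fromℕ<; toℕ<n)
open import Data.List using (List; []; _∷_; map; _++_; length; concat; filter; filterᵇ; take; drop; lookup; replicate; allFin)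
open import Data.List.Properties using (length-take; length-drop; take++drop≡id; length-map; length-++; filter-++; map-∘; length-replicate)
open import Data.List.Membership.Propositional using (_∈_)
open import Data.List.Membership.Propositional.Properties using (∈-lookup; ∈-map⁺; ∈-filter⁺; ∈-concatMap⁺; ∈-allFin)
open import Data.List.Membership.DecPropositional ℕ._≟_ using (_∈?_)
open import Data.List.Relation.Unary.Any as Any using (here; there)
open import Data.List.Relation.Unary.All as All using (All; []; _∷_)
open import Data.List.Relation.Unary.All.Properties using (map⁺; concat⁺; concat⁻; all-filter; ¬Any⇒All¬)
open import Data.List.Relation.Unary.AllPairs using (AllPairs; []; _∷_)
open import Data.List.Relation.Unary.Unique.Propositional using (Unique)
open import Data.List.Relation.Binary.Pointwise using (Pointwise; []; _∷_)
open import Data.List.Relation.Binary.Sublist.Propositional using (_⊆_; []; _∷_; _∷ʳ_; ⊆-refl; ⊆-trans; minimum)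
open import Data.List.Relation.Binary.Sublist.Propositional.Properties using (All-resp-⊆; filter-⊆; take-⊆; ++⁺ˡ)
open import Data.Product using (Σ; _×_; _,_; proj₁; proj₂; ∃)
open import Data.Sum using (_⊎_; inj₁; inj₂)
open import Function using (_∘_; id; Equivalence)
open import Relation.Nullary using (yes; no; contradiction; ¬?)
open import Relation.Binary.PropositionalEquality

module Counting where

  open import Data.Nat using (_<_; _≥_; _+_; _*_; _^_; _∸_; _≡ᵇ_; _≤ᵇ_; _<ᵇ_; _≤?_)
  open import Data.Nat.Properties
  open import Algebra.Properties.CommutativeSemigroup +-commutativeSemigroup using () renaming (interchange to +-interchange)
  open import Algebra.Properties.CommutativeSemigroup *-commutativeSemigroup using () renaming (x∙yz≈y∙xz to a*bc≡b*ac; interchange to *-interchange)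

  private variable
    A B : Set

  -- Sums over letters, subwords and transversals.

  ∑ : (A → ℕ) → List A → ℕ
  ∑ f []       = 0
  ∑ f (x ∷ xs) = f x + ∑ f xs

  -- ∑ₛ k F w is the sum of F over the k-subwords of w.
  ∑ₛ : ℕ → (List A → ℕ) → List A → ℕ
  ∑ₛ zero    F xs       = F []
  ∑ₛ (suc k) F []       = 0
  ∑ₛ (suc k) F (x ∷ xs) = ∑ₛ k (F ∘ (x ∷_)) xs + ∑ₛ (suc k) F xs

  -- ∑ₜ F ds is the sum of F over the transversals of ds (one letter from each block, in order).
  ∑ₜ : (List A → ℕ) → List (List A) → ℕ
  ∑ₜ F []       = F []
  ∑ₜ F (d ∷ ds) = ∑ (λ x → ∑ₜ (F ∘ (x ∷_)) ds) d

  ind : Bool → ℕ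
  ind true  = 1
  ind false = 0

  ∑-cong : {f g : A → ℕ} → (∀ x → f x ≡ g x) → ∀ xs → ∑ f xs ≡ ∑ g xs
  ∑-cong f≗g []       = refl
  ∑-cong f≗g (x ∷ xs) = cong₂ _+_ (f≗g x) (∑-cong f≗g xs)

  ∑-mono : {f g : A → ℕ} → (∀ x → f x ≤ g x) → ∀ xs → ∑ f xs ≤ ∑ g xs
  ∑-mono f≤g []       = z≤n
  ∑-mono f≤g (x ∷ xs) = +-mono-≤ (f≤g x) (∑-mono f≤g xs)

  ∑-⊆ : (f : A → ℕ) {xs ys : List A} → xs ⊆ ys → ∑ f xs ≤ ∑ f ys
  ∑-⊆ f []         = z≤n
  ∑-⊆ f (y ∷ʳ τ)   = ≤-trans (∑-⊆ f τ) (m≤n+m _ _)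
  ∑-⊆ f (refl ∷ τ) = +-monoʳ-≤ _ (∑-⊆ f τ)

  ∑-+ : (f g : A → ℕ) → ∀ xs → ∑ (λ x → f x + g x) xs ≡ ∑ f xs + ∑ g xs
  ∑-+ f g []       = refl
  ∑-+ f g (x ∷ xs) = trans (cong (f x + g x +_) (∑-+ f g xs)) (+-interchange (f x) _ _ _)

  ∑-*ˡ : ∀ c (f : A → ℕ) xs → ∑ (λ x → c * f x) xs ≡ c * ∑ f xs
  ∑-*ˡ c f []       = sym (*-zeroʳ c)
  ∑-*ˡ c f (x ∷ xs) = trans (cong (c * f x +_) (∑-*ˡ c f xs)) (sym (*-distribˡ-+ c (f x) _))

  ∑-const : ∀ c (xs : List A) → ∑ (λ _ → c) xs ≡ length xs * c
  ∑-const c []       = refl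
  ∑-const c (x ∷ xs) = cong (c +_) (∑-const c xs)

  ∑ₛ-cong : ∀ k {F G : List A → ℕ} → (∀ u → F u ≡ G u) → ∀ xs → ∑ₛ k F xs ≡ ∑ₛ k G xs
  ∑ₛ-cong zero    F≗G xs       = F≗G []
  ∑ₛ-cong (suc k) F≗G []       = refl
  ∑ₛ-cong (suc k) F≗G (x ∷ xs) = cong₂ _+_ (∑ₛ-cong k (F≗G ∘ (x ∷_)) xs) (∑ₛ-cong (suc k) F≗G xs)

  ∑ₛ-mono : ∀ k {F G : List A → ℕ} (xs : List A) →
            (∀ u → length u ≡ k → u ⊆ xs → F u ≤ G u) → ∑ₛ k F xs ≤ ∑ₛ k G xs
  ∑ₛ-mono zero    xs       F≤G = F≤G [] refl (minimum xs)
  ∑ₛ-mono (suc k) []       F≤G = z≤n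
  ∑ₛ-mono (suc k) (x ∷ xs) F≤G = +-mono-≤
    (∑ₛ-mono k xs (λ u |u|≡k τ → F≤G (x ∷ u) (cong suc |u|≡k) (refl ∷ τ)))
    (∑ₛ-mono (suc k) xs (λ u |u|≡k τ → F≤G u |u|≡k (x ∷ʳ τ)))

  ∑ₛ-+ : ∀ k (F G : List A → ℕ) xs → ∑ₛ k (λ u → F u + G u) xs ≡ ∑ₛ k F xs + ∑ₛ k G xs
  ∑ₛ-+ zero    F G xs       = refl
  ∑ₛ-+ (suc k) F G []       = refl
  ∑ₛ-+ (suc k) F G (x ∷ xs) =
    trans (cong₂ _+_ (∑ₛ-+ k (F ∘ (x ∷_)) (G ∘ (x ∷_)) xs) (∑ₛ-+ (suc k) F G xs))
          (+-interchange (∑ₛ k (F ∘ (x ∷_)) xs) _ _ _)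

  ∑ₛ-*ˡ : ∀ k c (F : List A → ℕ) xs → ∑ₛ k (λ u → c * F u) xs ≡ c * ∑ₛ k F xs
  ∑ₛ-*ˡ zero    c F xs       = refl
  ∑ₛ-*ˡ (suc k) c F []       = sym (*-zeroʳ c)
  ∑ₛ-*ˡ (suc k) c F (x ∷ xs) =
    trans (cong₂ _+_ (∑ₛ-*ˡ k c (F ∘ (x ∷_)) xs) (∑ₛ-*ˡ (suc k) c F xs))
          (sym (*-distribˡ-+ c (∑ₛ k (F ∘ (x ∷_)) xs) _))

  ∑ₛ-map : ∀ k (F : List B → ℕ) (h : A → B) xs → ∑ₛ k F (map h xs) ≡ ∑ₛ k (F ∘ map h) xs
  ∑ₛ-map zero    F h xs       = refl
  ∑ₛ-map (suc k) F h []       = refl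
  ∑ₛ-map (suc k) F h (x ∷ xs) = cong₂ _+_ (∑ₛ-map k (F ∘ (h x ∷_)) h xs) (∑ₛ-map (suc k) F h xs)

  ∑ₛ-zero : ∀ k (xs : List A) → ∑ₛ k (λ _ → 0) xs ≡ 0
  ∑ₛ-zero zero    xs       = refl
  ∑ₛ-zero (suc k) []       = refl
  ∑ₛ-zero (suc k) (x ∷ xs) = cong₂ _+_ (∑ₛ-zero k xs) (∑ₛ-zero (suc k) xs)

  ∑ₛ-∑ : ∀ k (H : B → List A → ℕ) (ys : List B) xs →
         ∑ₛ k (λ u → ∑ (λ y → H y u) ys) xs ≡ ∑ (λ y → ∑ₛ k (H y) xs) ys
  ∑ₛ-∑ k H []       xs = ∑ₛ-zero k xs
  ∑ₛ-∑ k H (y ∷ ys) xs =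
    trans (∑ₛ-+ k (H y) (λ u → ∑ (λ z → H z u) ys) xs) (cong (∑ₛ k (H y) xs +_) (∑ₛ-∑ k H ys xs))

  ∑ₛ-short : ∀ k (F : List A → ℕ) xs → length xs < k → ∑ₛ k F xs ≡ 0
  ∑ₛ-short (suc k) F []       _         = refl
  ∑ₛ-short (suc k) F (x ∷ xs) (s≤s |xs|<k) =
    cong₂ _+_ (∑ₛ-short k (F ∘ (x ∷_)) xs |xs|<k) (∑ₛ-short (suc k) F xs (m<n⇒m<1+n |xs|<k))

  ∑ₛ-⊆ : ∀ (F : List A → ℕ) {u xs} → u ⊆ xs → F u ≤ ∑ₛ (length u) F xs
  ∑ₛ-⊆ F []                 = ≤-refl
  ∑ₛ-⊆ F {[]}    (y ∷ʳ τ)   = ≤-refl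
  ∑ₛ-⊆ F {x ∷ u} (y ∷ʳ τ)   = ≤-trans (∑ₛ-⊆ F τ) (m≤n+m _ _)
  ∑ₛ-⊆ F {x ∷ u} (refl ∷ τ) = ≤-trans (∑ₛ-⊆ (F ∘ (x ∷_)) τ) (m≤m+n _ _)

  ∑ₛ-const : ∀ k c (xs : List A) → ∑ₛ k (λ _ → c) xs ≡ (length xs C k) * c
  ∑ₛ-const zero    c xs       = sym (+-identityʳ c)
  ∑ₛ-const (suc k) c []       = refl
  ∑ₛ-const (suc k) c (x ∷ xs) = begin
    ∑ₛ k (λ _ → c) xs + ∑ₛ (suc k) (λ _ → c) xs    ≡⟨ cong₂ _+_ (∑ₛ-const k c xs) (∑ₛ-const (suc k) c xs) ⟩
    (n C k) * c + (n C suc k) * c                  ≡⟨ *-distribʳ-+ c (n C k) _ ⟨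
    (n C k + n C suc k) * c                        ≡⟨ cong (_* c) (nCk+nC[k+1]≡[n+1]C[k+1] n k) ⟩
    (suc n C suc k) * c                            ∎
    where
    open ≡-Reasoning
    n = length xs

  -- Binomial coefficients and double counting.

  nCk>0 : ∀ {n k} → k ≤ n → 0 < n C k
  nCk>0 {n}     {zero}  k≤n       = s≤s z≤n
  nCk>0 {suc n} {suc k} (s≤s k≤n) =
    ≤-trans (nCk>0 k≤n) (≤-trans (m≤m+n _ _) (≤-reflexive (nCk+nC[k+1]≡[n+1]C[k+1] n k)))

  nCk≤n^k : ∀ n k → n C k ≤ n ^ k
  nCk≤n^k n       zero    = ≤-refl
  nCk≤n^k zero    (suc k) = z≤n
  nCk≤n^k (suc n) (suc k) = begin
    suc n C suc k                  ≡⟨ nCk+nC[k+1]≡[n+1]C[k+1] n k ⟨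
    n C k + n C suc k              ≤⟨ +-mono-≤ (nCk≤n^k n k) (nCk≤n^k n (suc k)) ⟩
    suc n * n ^ k                  ≤⟨ *-monoʳ-≤ (suc n) (^-monoˡ-≤ k (n≤1+n n)) ⟩
    suc n ^ suc k                  ∎
    where open ≤-Reasoning

  -- Each k-subword of w lies in C(n - k, j) of the (k + j)-subwords.
  ∑ₛ-∑ₛ : ∀ k j (F : List A → ℕ) xs →
          ∑ₛ (k + j) (∑ₛ k F) xs ≡ ((length xs ∸ k) C j) * ∑ₛ k F xs
  ∑ₛ-∑ₛ zero    j F xs       = ∑ₛ-const j (F []) xs
  ∑ₛ-∑ₛ (suc k) j F []       = sym (*-zeroʳ (0 C j))
  ∑ₛ-∑ₛ {A = A} (suc k) j F (x ∷ xs) = begin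
    ∑ₛ (k + j) (λ u → ∑ₛ k Fx u + ∑ₛ (suc k) F u) xs + ∑ₛ (suc k + j) (∑ₛ (suc k) F) xs
      ≡⟨ cong₂ _+_ (∑ₛ-+ (k + j) (∑ₛ k Fx) (∑ₛ (suc k) F) xs) (∑ₛ-∑ₛ (suc k) j F xs) ⟩
    ∑ₛ (k + j) (∑ₛ k Fx) xs + rest + ((n ∸ suc k) C j) * b
      ≡⟨ cong (λ a → a + rest + ((n ∸ suc k) C j) * b) (∑ₛ-∑ₛ k j Fx xs) ⟩
    ((n ∸ k) C j) * a + rest + ((n ∸ suc k) C j) * b
      ≡⟨ +-assoc (((n ∸ k) C j) * a) rest _ ⟩
    ((n ∸ k) C j) * a + (rest + ((n ∸ suc k) C j) * b)
      ≡⟨ cong (((n ∸ k) C j) * a +_) (pascal j) ⟩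
    ((n ∸ k) C j) * a + ((n ∸ k) C j) * b
      ≡⟨ *-distribˡ-+ ((n ∸ k) C j) a b ⟨
    ((n ∸ k) C j) * (a + b) ∎
    where
    open ≡-Reasoning
    n = length xs
    Fx = F ∘ (x ∷_)
    a = ∑ₛ k Fx xs
    b = ∑ₛ (suc k) F xs
    rest = ∑ₛ (k + j) (∑ₛ (suc k) F) xs
    vanish : ∑ₛ k (∑ₛ (suc k) F) xs ≡ 0
    vanish = n≤0⇒n≡0 (≤-trans
      (∑ₛ-mono k {G = λ _ → 0} xs (λ u |u|≡k _ → ≤-reflexive (∑ₛ-short (suc k) F u (s≤s (≤-reflexive |u|≡k)))))
      (≤-reflexive (∑ₛ-zero k xs)))
    pascal : ∀ j → ∑ₛ (k + j) (∑ₛ (suc k) F) xs + ((n ∸ suc k) C j) * b ≡ ((n ∸ k) C j) * b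
    pascal zero = cong (_+ (b + 0)) (trans (cong (λ i → ∑ₛ i (∑ₛ (suc k) F) xs) (+-identityʳ k)) vanish)
    pascal (suc j) with suc k ≤? n
    ... | yes k<n = begin
      ∑ₛ (k + suc j) (∑ₛ (suc k) F) xs + (N C suc j) * b
        ≡⟨ cong (_+ (N C suc j) * b) (trans (cong (λ i → ∑ₛ i (∑ₛ (suc k) F) xs) (+-suc k j)) (∑ₛ-∑ₛ (suc k) j F xs)) ⟩
      (N C j) * b + (N C suc j) * b
        ≡⟨ *-distribʳ-+ b (N C j) _ ⟨
      (N C j + N C suc j) * b
        ≡⟨ cong (_* b) (trans (nCk+nC[k+1]≡[n+1]C[k+1] N j) (cong (_C suc j) (sym (+-∸-assoc 1 k<n)))) ⟩
      ((n ∸ k) C suc j) * b ∎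
      where N = n ∸ suc k
    -- Truncated subtraction would spoil Pascal's rule here, but `xs` is too short to have a
    -- `suc k`-subword, so `b` is 0 and every term vanishes.
    ... | no k≮n = begin
      ∑ₛ (k + suc j) (∑ₛ (suc k) F) xs + ((n ∸ suc k) C suc j) * b
        ≡⟨ cong₂ _+_ (trans (cong (λ i → ∑ₛ i (∑ₛ (suc k) F) xs) (+-suc k j)) (trans (∑ₛ-∑ₛ (suc k) j F xs) (times0 ((n ∸ suc k) C j)))) (times0 ((n ∸ suc k) C suc j)) ⟩
      0
        ≡⟨ times0 ((n ∸ k) C suc j) ⟨
      ((n ∸ k) C suc j) * b ∎
      where
      times0 : ∀ c → c * b ≡ 0
      times0 c = trans (cong (c *_) (∑ₛ-short (suc k) F xs (≰⇒> k≮n))) (*-zeroʳ c)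

  ∑ₜ-+ : ∀ (F G : List A → ℕ) ds → ∑ₜ (λ u → F u + G u) ds ≡ ∑ₜ F ds + ∑ₜ G ds
  ∑ₜ-+ F G []       = refl
  ∑ₜ-+ F G (d ∷ ds) =
    trans (∑-cong (λ x → ∑ₜ-+ (F ∘ (x ∷_)) (G ∘ (x ∷_)) ds) d)
          (∑-+ (λ x → ∑ₜ (F ∘ (x ∷_)) ds) (λ x → ∑ₜ (G ∘ (x ∷_)) ds) d)

  ∑ₜ-mono-const : ∀ {s} c (F : List A → ℕ) ds → All (λ d → length d ≡ s) ds →
                  (∀ u → length u ≡ length ds → c ≤ F u) → s ^ length ds * c ≤ ∑ₜ F ds
  ∑ₜ-mono-const c F []       []         c≤F = ≤-trans (≤-reflexive (+-identityʳ c)) (c≤F [] refl)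
  ∑ₜ-mono-const {s = s} c F (d ∷ ds) (refl ∷ p) c≤F = begin
    (length d * s ^ length ds) * c  ≡⟨ *-assoc (length d) (s ^ length ds) c ⟩
    length d * (s ^ length ds * c)  ≡⟨ ∑-const (s ^ length ds * c) d ⟨
    ∑ (λ _ → s ^ length ds * c) d
      ≤⟨ ∑-mono (λ x → ∑ₜ-mono-const c (F ∘ (x ∷_)) ds p (λ u e → c≤F (x ∷ u) (cong suc e))) d ⟩
    ∑ₜ F (d ∷ ds)                   ∎
    where open ≤-Reasoning

  -- Both sides count pairs of a transversal and a j-subword of it; multiplying by s ^ j avoids subtraction.
  ∑ₜ-∑ₛ : ∀ {s} j (F : List A → ℕ) ds → All (λ d → length d ≡ s) ds →
          s ^ j * ∑ₜ (∑ₛ j F) ds ≡ s ^ length ds * ∑ₛ j (∑ₜ F) ds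
  ∑ₜ-∑ₛ zero    F []       _ = refl
  ∑ₜ-∑ₛ {s = s} (suc j) F [] _ = *-zeroʳ (s ^ suc j)
  ∑ₜ-∑ₛ {s = s} zero    F (d ∷ ds) (refl ∷ p) = begin
    ∑ (λ x → ∑ₜ (λ _ → F []) ds) d + 0
      ≡⟨ +-identityʳ _ ⟩
    ∑ (λ x → ∑ₜ (λ _ → F []) ds) d
      ≡⟨ ∑-const _ d ⟩
    s * ∑ₜ (λ _ → F []) ds
      ≡⟨ cong (s *_) (trans (sym (+-identityʳ _)) (∑ₜ-∑ₛ zero F ds p)) ⟩
    s * (s ^ length ds * F [])
      ≡⟨ *-assoc s _ _ ⟨
    s * s ^ length ds * F [] ∎
    where open ≡-Reasoning
  ∑ₜ-∑ₛ {s = s} (suc j) F (d ∷ ds) (refl ∷ p) = begin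
    s ^ suc j * ∑ (λ x → ∑ₜ (λ u → ∑ₛ j (F ∘ (x ∷_)) u + ∑ₛ (suc j) F u) ds) d
      ≡⟨ ∑-*ˡ (s ^ suc j) _ d ⟨
    ∑ (λ x → s ^ suc j * ∑ₜ (λ u → ∑ₛ j (F ∘ (x ∷_)) u + ∑ₛ (suc j) F u) ds) d
      ≡⟨ ∑-cong step d ⟩
    ∑ (λ x → s * M * ∑ₛ j (∑ₜ (F ∘ (x ∷_))) ds + M * b) d
      ≡⟨ ∑-+ _ _ d ⟩
    ∑ (λ x → s * M * ∑ₛ j (∑ₜ (F ∘ (x ∷_))) ds) d + ∑ (λ _ → M * b) d
      ≡⟨ cong₂ _+_ (∑-*ˡ (s * M) _ d) (trans (∑-const (M * b) d) (sym (*-assoc s M b))) ⟩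
    s * M * ∑ (λ x → ∑ₛ j (∑ₜ (F ∘ (x ∷_))) ds) d + s * M * b
      ≡⟨ *-distribˡ-+ (s * M) _ b ⟨
    s * M * (∑ (λ x → ∑ₛ j (∑ₜ (F ∘ (x ∷_))) ds) d + b)
      ≡⟨ cong (λ a → s * M * (a + b)) (∑ₛ-∑ j (λ x → ∑ₜ (F ∘ (x ∷_))) d ds) ⟨
    s * M * (∑ₛ j (λ c → ∑ₜ F (d ∷ c)) ds + b) ∎
    where
    open ≡-Reasoning
    M = s ^ length ds
    b = ∑ₛ (suc j) (∑ₜ F) ds
    -- Subwords using `x` reduce to the case `j` and leave one factor `s` over; those avoiding `x`
    -- stay at `suc j` and gain their factor `s` only from the sum over `d`.
    step : ∀ x → s ^ suc j * ∑ₜ (λ u → ∑ₛ j (F ∘ (x ∷_)) u + ∑ₛ (suc j) F u) ds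
               ≡ s * M * ∑ₛ j (∑ₜ (F ∘ (x ∷_))) ds + M * b
    step x = begin
      s ^ suc j * ∑ₜ (λ u → ∑ₛ j (F ∘ (x ∷_)) u + ∑ₛ (suc j) F u) ds
        ≡⟨ cong (s ^ suc j *_) (∑ₜ-+ (∑ₛ j (F ∘ (x ∷_))) (∑ₛ (suc j) F) ds) ⟩
      s ^ suc j * (∑ₜ (∑ₛ j (F ∘ (x ∷_))) ds + ∑ₜ (∑ₛ (suc j) F) ds)
        ≡⟨ *-distribˡ-+ (s ^ suc j) _ _ ⟩
      s * s ^ j * ∑ₜ (∑ₛ j (F ∘ (x ∷_))) ds + s ^ suc j * ∑ₜ (∑ₛ (suc j) F) ds
        ≡⟨ cong₂ _+_ (trans (*-assoc s (s ^ j) _) (trans (cong (s *_) (∑ₜ-∑ₛ j (F ∘ (x ∷_)) ds p)) (sym (*-assoc s M _)))) (∑ₜ-∑ₛ (suc j) F ds p) ⟩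
      s * M * ∑ₛ j (∑ₜ (F ∘ (x ∷_))) ds + M * b ∎

  ∑ₛ-mono-⊆ : ∀ k (F : List A → ℕ) {xs ys} → xs ⊆ ys → ∑ₛ k F xs ≤ ∑ₛ k F ys
  ∑ₛ-mono-⊆ zero    F τ          = ≤-refl
  ∑ₛ-mono-⊆ (suc k) F []         = z≤n
  ∑ₛ-mono-⊆ (suc k) F (y ∷ʳ τ)   = ≤-trans (∑ₛ-mono-⊆ (suc k) F τ) (m≤n+m _ _)
  ∑ₛ-mono-⊆ (suc k) F (refl ∷ τ) = +-mono-≤ (∑ₛ-mono-⊆ k _ τ) (∑ₛ-mono-⊆ (suc k) F τ)

  -- Monotone words and the Erdős-Szekeres argument.

  T⇒≡true : ∀ {b} → T b → b ≡ true
  T⇒≡true = Equivalence.to T-≡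

  ≤⇒≤ᵇ-true : ∀ {m n} → m ≤ n → (m ≤ᵇ n) ≡ true
  ≤⇒≤ᵇ-true = T⇒≡true ∘ ≤⇒≤ᵇ

  nondecreasing⁺ : ∀ {u} → AllPairs _≤_ u → nondecreasing u ≡ true
  nondecreasing⁺ []                       = refl
  nondecreasing⁺ (_ ∷ [])                 = refl
  nondecreasing⁺ ((x≤y ∷ _) ∷ p@(_ ∷ _)) = cong₂ _∧_ (≤⇒≤ᵇ-true x≤y) (nondecreasing⁺ p)

  nonincreasing⁺ : ∀ {u} → AllPairs _≥_ u → nonincreasing u ≡ true
  nonincreasing⁺ []                       = refl
  nonincreasing⁺ (_ ∷ [])                 = refl
  nonincreasing⁺ ((x≥y ∷ _) ∷ p@(_ ∷ _)) = cong₂ _∧_ (≤⇒≤ᵇ-true x≥y) (nonincreasing⁺ p)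

  length-filter-split : ∀ x (xs : List ℕ) →
    length xs ≡ length (filter (x ≤?_) xs) + length (filter (¬? ∘ (x ≤?_)) xs)
  length-filter-split x []       = refl
  length-filter-split x (y ∷ ys) with x ≤ᵇ y
  ... | true  = cong suc (length-filter-split x ys)
  ... | false = trans (cong suc (length-filter-split x ys)) (sym (+-suc (length (filter (x ≤?_) ys)) _))

  -- A Ramsey-style halving argument: less sharp than (a - 1)(b - 1) + 1, but only finiteness of the bound matters.
  erdős–szekeres : ∀ a b (xs : List ℕ) → 2 ^ (a + b) ≤ length xs →
    (∃ λ u → u ⊆ xs × length u ≡ a × AllPairs _≤_ u) ⊎
    (∃ λ u → u ⊆ xs × length u ≡ b × AllPairs _≥_ u)
  erdős–szekeres zero    b       xs _ = inj₁ ([] , minimum xs , refl , [])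
  erdős–szekeres (suc a) zero    xs _ = inj₂ ([] , minimum xs , refl , [])
  erdős–szekeres (suc a) (suc b) []       2^≤ = contradiction 2^≤ (<⇒≱ (m^n>0 2 (suc a + suc b)))
  erdős–szekeres (suc a) (suc b) (x ∷ xs) 2^≤ with 2 ^ (a + suc b) ≤? length (filter (x ≤?_) xs)
  ... | yes many with erdős–szekeres a (suc b) (filter (x ≤?_) xs) many
  ...   | inj₁ (u , τ , |u| , u↗) =
          inj₁ (x ∷ u , refl ∷ ⊆-trans τ (filter-⊆ _ xs) , cong suc |u| , All-resp-⊆ τ (all-filter _ xs) ∷ u↗)
  ...   | inj₂ (u , τ , rest) = inj₂ (u , x ∷ʳ ⊆-trans τ (filter-⊆ _ xs) , rest)
  erdős–szekeres (suc a) (suc b) (x ∷ xs) 2^≤ | no few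
    with erdős–szekeres (suc a) b (filter (¬? ∘ (x ≤?_)) xs) many
    where
    p q : ℕ
    p = length (filter (x ≤?_) xs)
    q = length (filter (¬? ∘ (x ≤?_)) xs)
    -- The head of the word absorbs the off-by-one: `few` bounds `suc p` by half of
    -- `2 ^ (suc a + suc b)`, and `suc p + q` is the length of the whole word.
    many : 2 ^ (suc a + b) ≤ q
    many = +-cancelˡ-≤ (suc p) _ _ (begin
      suc p + 2 ^ (suc a + b)              ≤⟨ +-monoˡ-≤ _ (≰⇒> few) ⟩
      2 ^ (a + suc b) + 2 ^ (suc a + b)    ≡⟨ cong (λ e → 2 ^ (a + suc b) + 2 ^ e) (sym (+-suc a b)) ⟩
      2 ^ (a + suc b) + 2 ^ (a + suc b)    ≡⟨ cong (2 ^ (a + suc b) +_) (sym (+-identityʳ _)) ⟩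
      2 ^ (suc a + suc b)                  ≤⟨ 2^≤ ⟩
      suc (length xs)                      ≡⟨ cong suc (length-filter-split x xs) ⟩
      suc p + q                            ∎)
      where open ≤-Reasoning
  ... | inj₁ (u , τ , rest) = inj₁ (u , x ∷ʳ ⊆-trans τ (filter-⊆ _ xs) , rest)
  ... | inj₂ (u , τ , |u| , u↘) =
        inj₂ (x ∷ u , refl ∷ ⊆-trans τ (filter-⊆ _ xs) , cong suc |u| ,
              All.map (<⇒≤ ∘ ≰⇒>) (All-resp-⊆ τ (all-filter _ xs)) ∷ u↘)

  ∑ₛ-monotone>0 : ∀ j (xs : List ℕ) → 2 ^ (j + j) ≤ length xs → 1 ≤ ∑ₛ j (ind ∘ monotone) xs
  ∑ₛ-monotone>0 j xs 2^≤ with erdős–szekeres j j xs 2^≤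
  ... | inj₁ (u , τ , refl , u↗) =
        ≤-trans (≤-reflexive (cong ind (sym (cong (_∨ nonincreasing u) (nondecreasing⁺ u↗))))) (∑ₛ-⊆ (ind ∘ monotone) τ)
  ... | inj₂ (u , τ , refl , u↘) =
        ≤-trans (≤-reflexive (cong ind (sym (trans (cong (nondecreasing u ∨_) (nonincreasing⁺ u↘)) (∨-zeroʳ _)))))
                (∑ₛ-⊆ (ind ∘ monotone) τ)

  -- Recurring letters and tied subwords.

  nonlast : List ℕ → List ℕ
  nonlast [] = []
  nonlast (x ∷ xs) with x ∈? xs
  ... | yes _ = x ∷ nonlast xs
  ... | no  _ = nonlast xs

  nonlast-⊆ : ∀ xs → nonlast xs ⊆ xs
  nonlast-⊆ [] = []
  nonlast-⊆ (x ∷ xs) with x ∈? xs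
  ... | yes _ = refl ∷ nonlast-⊆ xs
  ... | no  _ = x ∷ʳ nonlast-⊆ xs

  lookup-injective : ∀ {xs : List A} → Unique xs → ∀ {i j} → lookup xs i ≡ lookup xs j → i ≡ j
  lookup-injective (_ ∷ _)  {zero}  {zero}  _  = refl
  lookup-injective (x≢ ∷ _) {zero}  {suc j} eq = contradiction eq (All.lookup x≢ (∈-lookup j))
  lookup-injective (x≢ ∷ _) {suc i} {zero}  eq = contradiction (sym eq) (All.lookup x≢ (∈-lookup i))
  lookup-injective (_ ∷ p)  {suc i} {suc j} eq = cong suc (lookup-injective p eq)

  unique-bounded : ∀ {s xs} → Unique xs → All (_< s) xs → length xs ≤ s
  unique-bounded {xs = xs} p xs<s = injective⇒≤ {f = λ i → fromℕ< (All.lookup xs<s (∈-lookup {xs = xs} i))}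
    (λ eq → lookup-injective p (fromℕ<-injective _ _ _ _ eq))

  -- The letters dropped by `nonlast` are last occurrences, one for each letter that appears, so
  -- they are distinct. Over an alphabet of size `s` at most `s` positions are lost, which gives
  -- `length-nonlast`.
  last-occurrences : ∀ xs → ∃ λ us → Unique us × us ⊆ xs × length xs ≡ length us + length (nonlast xs)
  last-occurrences [] = [] , [] , [] , refl
  last-occurrences (x ∷ xs) with last-occurrences xs | x ∈? xs
  ... | us , u! , τ , eq | yes _   = us , u! , x ∷ʳ τ , trans (cong suc eq) (sym (+-suc (length us) _))
  ... | us , u! , τ , eq | no x∉xs = x ∷ us , All-resp-⊆ τ (¬Any⇒All¬ xs x∉xs) ∷ u! , refl ∷ τ , cong suc eq

  length-nonlast : ∀ {s xs} → All (_< s) xs → length xs ≤ s + length (nonlast xs)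
  length-nonlast {xs = xs} xs<s with us , u! , τ , eq ← last-occurrences xs =
    ≤-trans (≤-reflexive eq) (+-monoˡ-≤ _ (unique-bounded u! (All-resp-⊆ τ xs<s)))

  -- Lifts a weight from `x v` to `x x v`. For `F = ind ∘ monotone` this is the indicator of tied
  -- words, because doubling the first letter does not affect monotonicity.
  tie : (List ℕ → ℕ) → List ℕ → ℕ
  tie F (x ∷ y ∷ u) = if x ≡ᵇ y then F (x ∷ u) else 0
  tie F _           = 0

  tie-refl : ∀ F x u → tie F (x ∷ x ∷ u) ≡ F (x ∷ u)
  tie-refl F x u rewrite T⇒≡true (≡⇒≡ᵇ x x refl) = refl

  -- One fixed copy of `x` inside `b` serves as the second letter, and the rest of the subword is
  -- taken from `v`.
  ∑ₛ-tie-∈ : ∀ j F {x b} v → x ∈ b → ∑ₛ j (F ∘ (x ∷_)) v ≤ ∑ₛ (suc j) (tie F ∘ (x ∷_)) (b ++ v)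
  ∑ₛ-tie-∈ j F {x} {_ ∷ b} v (here refl) = begin
    ∑ₛ j (F ∘ (x ∷_)) v                        ≤⟨ ∑ₛ-mono-⊆ j _ (++⁺ˡ b ⊆-refl) ⟩
    ∑ₛ j (F ∘ (x ∷_)) (b ++ v)                 ≡⟨ ∑ₛ-cong j (tie-refl F x) (b ++ v) ⟨
    ∑ₛ j (λ u → tie F (x ∷ x ∷ u)) (b ++ v)    ≤⟨ m≤m+n _ _ ⟩
    ∑ₛ (suc j) (tie F ∘ (x ∷_)) (x ∷ b ++ v)   ∎
    where open ≤-Reasoning
  ∑ₛ-tie-∈ j F v (there x∈b) = ≤-trans (∑ₛ-tie-∈ j F v x∈b) (m≤n+m _ _)

  -- Tied subwords are sorted by the position of their first letter, so nothing is counted twice: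
  -- either it is a `nonlast` letter of `b`, with its second copy in `b` and the rest in `v`, or
  -- everything lies in `v`.
  ∑ₛ-tie-++ : ∀ j F b v →
    ∑ (λ x → ∑ₛ j (F ∘ (x ∷_)) v) (nonlast b) + ∑ₛ (2 + j) (tie F) v ≤ ∑ₛ (2 + j) (tie F) (b ++ v)
  ∑ₛ-tie-++ j F []      v = ≤-refl
  ∑ₛ-tie-++ j F (x ∷ b) v with x ∈? b
  ... | yes x∈b = ≤-trans (≤-reflexive (+-assoc (∑ₛ j (F ∘ (x ∷_)) v) _ _))
                          (+-mono-≤ (∑ₛ-tie-∈ j F v x∈b) (∑ₛ-tie-++ j F b v))
  ... | no  _   = ≤-trans (∑ₛ-tie-++ j F b v) (m≤n+m _ _)

  ∑ₛ-++ : ∀ j (F : List A → ℕ) b v →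
    ∑ (λ x → ∑ₛ j (F ∘ (x ∷_)) v) b + ∑ₛ (suc j) F v ≤ ∑ₛ (suc j) F (b ++ v)
  ∑ₛ-++ j F []      v = ≤-refl
  ∑ₛ-++ j F (x ∷ b) v = ≤-trans (≤-reflexive (+-assoc (∑ₛ j (F ∘ (x ∷_)) v) _ _))
    (+-mono-≤ (∑ₛ-mono-⊆ j _ (++⁺ˡ b ⊆-refl)) (∑ₛ-++ j F b v))

  -- Choosing `j` blocks and one letter from each yields a `j`-subword of the concatenation, and
  -- different choices use different position sets.
  ∑ₛ-∑ₜ-concat : ∀ j (F : List A → ℕ) {ds bs} → Pointwise _⊆_ ds bs → ∑ₛ j (∑ₜ F) ds ≤ ∑ₛ j F (concat bs)
  ∑ₛ-∑ₜ-concat zero    F _ = ≤-refl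
  ∑ₛ-∑ₜ-concat (suc j) F [] = z≤n
  ∑ₛ-∑ₜ-concat (suc j) F {d ∷ ds} {b ∷ bs} (τ ∷ τs) = begin
    ∑ₛ j (λ c → ∑ₜ F (d ∷ c)) ds + ∑ₛ (suc j) (∑ₜ F) ds
      ≡⟨ cong (_+ ∑ₛ (suc j) (∑ₜ F) ds) (∑ₛ-∑ j (λ x → ∑ₜ (F ∘ (x ∷_))) d ds) ⟩
    ∑ (λ x → ∑ₛ j (∑ₜ (F ∘ (x ∷_))) ds) d + ∑ₛ (suc j) (∑ₜ F) ds
      ≤⟨ +-mono-≤ (∑-mono (λ x → ∑ₛ-∑ₜ-concat j (F ∘ (x ∷_)) τs) d) (∑ₛ-∑ₜ-concat (suc j) F τs) ⟩
    ∑ (λ x → ∑ₛ j (F ∘ (x ∷_)) (concat bs)) d + ∑ₛ (suc j) F (concat bs)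
      ≤⟨ +-monoˡ-≤ _ (∑-⊆ _ τ) ⟩
    ∑ (λ x → ∑ₛ j (F ∘ (x ∷_)) (concat bs)) b + ∑ₛ (suc j) F (concat bs)
      ≤⟨ ∑ₛ-++ j F b (concat bs) ⟩
    ∑ₛ (suc j) F (b ++ concat bs) ∎
    where open ≤-Reasoning

  -- The first letter of a partial transversal can be doubled: its block contains a later copy of it.
  ∑ₛ-∑ₜ-tie : ∀ j F {ds bs} → Pointwise (λ d b → d ⊆ nonlast b) ds bs →
              ∑ₛ (suc j) (∑ₜ F) ds ≤ ∑ₛ (2 + j) (tie F) (concat bs)
  ∑ₛ-∑ₜ-tie j F [] = z≤n
  ∑ₛ-∑ₜ-tie j F {d ∷ ds} {b ∷ bs} (τ ∷ τs) = begin
    ∑ₛ j (λ c → ∑ₜ F (d ∷ c)) ds + ∑ₛ (suc j) (∑ₜ F) ds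
      ≡⟨ cong (_+ ∑ₛ (suc j) (∑ₜ F) ds) (∑ₛ-∑ j (λ x → ∑ₜ (F ∘ (x ∷_))) d ds) ⟩
    ∑ (λ x → ∑ₛ j (∑ₜ (F ∘ (x ∷_))) ds) d + ∑ₛ (suc j) (∑ₜ F) ds
      ≤⟨ +-mono-≤ (∑-mono (λ x → ∑ₛ-∑ₜ-concat j (F ∘ (x ∷_)) (sublists τs)) d) (∑ₛ-∑ₜ-tie j F τs) ⟩
    ∑ (λ x → ∑ₛ j (F ∘ (x ∷_)) (concat bs)) d + ∑ₛ (2 + j) (tie F) (concat bs)
      ≤⟨ +-monoˡ-≤ _ (∑-⊆ _ τ) ⟩
    ∑ (λ x → ∑ₛ j (F ∘ (x ∷_)) (concat bs)) (nonlast b) + ∑ₛ (2 + j) (tie F) (concat bs)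
      ≤⟨ ∑ₛ-tie-++ j F b (concat bs) ⟩
    ∑ₛ (2 + j) (tie F) (b ++ concat bs) ∎
    where
    open ≤-Reasoning
    sublists : ∀ {ds bs} → Pointwise (λ d b → d ⊆ nonlast b) ds bs → Pointwise _⊆_ ds bs
    sublists []                 = []
    sublists {bs = b ∷ _} (σ ∷ σs) = ⊆-trans σ (nonlast-⊆ b) ∷ sublists σs

  -- Lower bound for the number of tied subwords.

  split-blocks : ∀ M L (u : List A) → length u ≡ M * L →
    ∃ λ bs → concat bs ≡ u × length bs ≡ M × All (λ b → length b ≡ L) bs
  split-blocks zero    L []      _  = [] , refl , refl , []
  split-blocks (suc M) L u |u|
    with bs , eq , |bs| , |b| ← split-blocks M L (drop L u)
           (trans (length-drop L u) (trans (cong (_∸ L) |u|) (m+n∸m≡n L (M * L)))) =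
    take L u ∷ bs , trans (cong (take L u ++_) eq) (take++drop≡id L u) , cong suc |bs| ,
    trans (length-take L u) (m≤n⇒m⊓n≡m (≤-trans (m≤m+n L _) (≤-reflexive (sym |u|)))) ∷ |b|

  tied : ℕ → List ℕ → ℕ
  tied k = ∑ₛ k (tie (ind ∘ monotone))

  -- Every full transversal contains a monotone partial one of `suc j` letters, and each partial one
  -- extends to the same number of full ones. Comparing the two counts leaves at least `s ^ suc j`
  -- monotone partial transversals, each of which yields a tied subword.
  tied-blocks : ∀ j s .{{_ : NonZero s}} u → All (_< s) u → length u ≡ 2 ^ (suc j + suc j) * (s + s) →
                s ^ suc j ≤ tied (2 + j) u
  tied-blocks j s u u<s |u| with split-blocks (2 ^ (suc j + suc j)) (s + s) u |u|
  ... | bs , refl , |bs| , |b| = *-cancelʳ-≤ _ _ (s ^ length ds) (begin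
    s ^ suc j * s ^ length ds
      ≡⟨ cong (s ^ suc j *_) (*-identityʳ _) ⟨
    s ^ suc j * (s ^ length ds * 1)
      -- A transversal has one letter per block, and the number of blocks is exactly the length at
      -- which Erdős-Szekeres provides a monotone `suc j`-subword.
      ≤⟨ *-monoʳ-≤ (s ^ suc j) (∑ₜ-mono-const 1 (∑ₛ (suc j) F) ds |d| (λ v |v| →
           ∑ₛ-monotone>0 (suc j) v (≤-reflexive (sym (trans |v| (trans (length-map _ bs) |bs|)))))) ⟩
    s ^ suc j * ∑ₜ (∑ₛ (suc j) F) ds
      ≡⟨ ∑ₜ-∑ₛ (suc j) F ds |d| ⟩
    s ^ length ds * ∑ₛ (suc j) (∑ₜ F) ds
      ≤⟨ *-monoʳ-≤ (s ^ length ds) (∑ₛ-∑ₜ-tie j F (pick-⊆ bs)) ⟩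
    s ^ length ds * tied (2 + j) (concat bs)
      ≡⟨ *-comm (s ^ length ds) _ ⟩
    tied (2 + j) (concat bs) * s ^ length ds ∎)
    where
    open ≤-Reasoning
    F = ind ∘ monotone
    -- A block of length `s + s` keeps at least `s` letters under `nonlast`; truncation to exactly
    -- `s` gives all blocks the equal size that `∑ₜ-∑ₛ` requires.
    pick : List ℕ → List ℕ
    pick = take s ∘ nonlast
    ds = map pick bs
    instance _ = m^n≢0 s (length ds)
    pick-⊆ : ∀ cs → Pointwise (λ d b → d ⊆ nonlast b) (map pick cs) cs
    pick-⊆ []       = []
    pick-⊆ (c ∷ cs) = take-⊆ s (nonlast c) ∷ pick-⊆ cs
    |pick| : ∀ {cs} → All (λ b → length b ≡ s + s) cs → All (All (_< s)) cs → All (λ d → length d ≡ s) (map pick cs)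
    |pick| []         []         = []
    |pick| {c ∷ _} (|c| ∷ |cs|) (c<s ∷ cs<s) =
      trans (length-take s (nonlast c)) (m≤n⇒m⊓n≡m (+-cancelˡ-≤ s _ _
        (≤-trans (≤-reflexive (sym |c|)) (length-nonlast c<s)))) ∷ |pick| |cs| cs<s
    |d| = |pick| |b| (concat⁻ u<s)

  -- Makes the sampled length `m` at least `k`, so that `m ∸ k` is a true difference.
  k≤2^[k+k]*[s+s] : ∀ j s .{{_ : NonZero s}} → 2 + j ≤ 2 ^ (suc j + suc j) * (s + s)
  k≤2^[k+k]*[s+s] j s@(suc s-1) = begin
    2 + j                              ≤⟨ s≤s (s≤s (m≤m+n j j)) ⟩
    2 + (j + j)                        ≡⟨ cong suc (+-suc j j) ⟨
    suc j + suc j                      ≤⟨ n≤2^n (suc j + suc j) ⟩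
    2 ^ (suc j + suc j)                ≤⟨ m≤m*n (2 ^ (suc j + suc j)) (s + s) ⟩
    2 ^ (suc j + suc j) * (s + s)      ∎
    where
    open ≤-Reasoning
    n≤2^n : ∀ n → n ≤ 2 ^ n
    n≤2^n zero    = z≤n
    n≤2^n (suc n) = +-mono-≤ (m^n>0 2 n) (≤-trans (n≤2^n n) (≤-reflexive (sym (+-identityʳ _))))

  -- Average tied-blocks over the subwords of length m = 2sM.
  tied-lower : ∀ j s .{{_ : NonZero s}} w → All (_< s) w →
    let k = 2 + j; M = 2 ^ (suc j + suc j) in
    M * (s + s) ≤ length w → length w C k ≤ s * (2 * M) ^ k * tied k w
  tied-lower j s w w<s m≤n = *-cancelˡ-≤ (s ^ suc j) (begin
    s ^ suc j * (n C k)                              ≤⟨ averaged ⟩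
    m ^ k * tied k w                                 ≡⟨ cong (_* tied k w) m^k ⟩
    s ^ suc j * (s * (2 * M) ^ k) * tied k w         ≡⟨ *-assoc (s ^ suc j) _ _ ⟩
    s ^ suc j * (s * (2 * M) ^ k * tied k w)         ∎)
    where
    open ≤-Reasoning
    k = 2 + j
    M = 2 ^ (suc j + suc j)
    m = M * (s + s)
    n = length w
    i = m ∸ k
    instance _ = m^n≢0 s (suc j)
    k≤m : k ≤ m
    k≤m = k≤2^[k+k]*[s+s] j s
    k+i≡m : k + i ≡ m
    k+i≡m = m+[n∸m]≡n k≤m
    -- The number of `m`-subwords through a given `k`-subword; it is positive because `m ≤ n`, and
    -- so it can be cancelled.
    K = (n ∸ k) C i
    instance _ = >-nonZero (nCk>0 {n ∸ k} {i} (∸-monoˡ-≤ k m≤n))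
    F = tie (ind ∘ monotone)
    -- Of the `k` factors `s` in `m ^ k`, all but one cancel against the bound of `tied-blocks`. The
    -- one left over is the source of `1/s` in the theorem.
    m^k : m ^ k ≡ s ^ suc j * (s * (2 * M) ^ k)
    m^k = trans (cong (_^ k) (reorder M s)) (trans (^-distribʳ-* k s (2 * M))
      (trans (cong (_* (2 * M) ^ k) (*-comm s (s ^ suc j))) (*-assoc (s ^ suc j) s _)))
      where
      reorder : ∀ M s → M * (s + s) ≡ s * (2 * M)
      reorder = solve-∀
      ^-distribʳ-* : ∀ e a b → (a * b) ^ e ≡ a ^ e * b ^ e
      ^-distribʳ-* zero    a b = refl
      ^-distribʳ-* (suc e) a b = trans (cong (a * b *_) (^-distribʳ-* e a b)) (*-interchange a b (a ^ e) (b ^ e))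
    local : ∀ u → length u ≡ k + i → u ⊆ w → s ^ suc j * ∑ₛ k (λ _ → 1) u ≤ m ^ k * tied k u
    local u |u| τ = begin
      s ^ suc j * ∑ₛ k (λ _ → 1) u   ≡⟨ cong (s ^ suc j *_) (trans (∑ₛ-const k 1 u) (*-identityʳ _)) ⟩
      s ^ suc j * (length u C k)     ≤⟨ *-mono-≤ (tied-blocks j s u (All-resp-⊆ τ w<s) (trans |u| k+i≡m))
                                          (≤-trans (nCk≤n^k (length u) k) (≤-reflexive (cong (_^ k) (trans |u| k+i≡m)))) ⟩
      tied k u * m ^ k               ≡⟨ *-comm (tied k u) _ ⟩
      m ^ k * tied k u               ∎
    averaged : s ^ suc j * (n C k) ≤ m ^ k * tied k w
    averaged = *-cancelˡ-≤ K (begin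
      K * (s ^ suc j * (n C k))
        ≡⟨ cong (λ c → K * (s ^ suc j * c)) (trans (∑ₛ-const k 1 w) (*-identityʳ _)) ⟨
      K * (s ^ suc j * ∑ₛ k (λ _ → 1) w)
        ≡⟨ a*bc≡b*ac K (s ^ suc j) _ ⟩
      s ^ suc j * (K * ∑ₛ k (λ _ → 1) w)
        ≡⟨ cong (s ^ suc j *_) (∑ₛ-∑ₛ k i (λ _ → 1) w) ⟨
      s ^ suc j * ∑ₛ (k + i) (∑ₛ k (λ _ → 1)) w
        ≡⟨ ∑ₛ-*ˡ (k + i) (s ^ suc j) _ w ⟨
      ∑ₛ (k + i) (λ u → s ^ suc j * ∑ₛ k (λ _ → 1) u) w
        ≤⟨ ∑ₛ-mono (k + i) w local ⟩
      ∑ₛ (k + i) (λ u → m ^ k * tied k u) w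
        ≡⟨ ∑ₛ-*ˡ (k + i) (m ^ k) _ w ⟩
      m ^ k * ∑ₛ (k + i) (tied k) w
        ≡⟨ cong (m ^ k *_) (∑ₛ-∑ₛ k i F w) ⟩
      m ^ k * (K * tied k w)
        ≡⟨ a*bc≡b*ac (m ^ k) K _ ⟩
      K * (m ^ k * tied k w) ∎)

  -- Tie-breaking keys, chosen by averaging.

  AllPairs-resp-⊆ : {R : A → A → Set} {xs ys : List A} → xs ⊆ ys → AllPairs R ys → AllPairs R xs
  AllPairs-resp-⊆ []         []       = []
  AllPairs-resp-⊆ (_ ∷ʳ τ)   (_ ∷ p)  = AllPairs-resp-⊆ τ p
  AllPairs-resp-⊆ (refl ∷ τ) (px ∷ p) = All-resp-⊆ τ px ∷ AllPairs-resp-⊆ τ p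

  ∑-∈ : (f : A → ℕ) {x : A} {xs : List A} → x ∈ xs → f x ≤ ∑ f xs
  ∑-∈ f (here refl) = m≤m+n _ _
  ∑-∈ f (there x∈)  = ≤-trans (∑-∈ f x∈) (m≤n+m _ _)

  ∑-mono-< : {f g : A → ℕ} → (∀ x → f x ≤ g x) → ∀ {x xs} → x ∈ xs → f x < g x → ∑ f xs < ∑ g xs
  ∑-mono-< f≤g {xs = _ ∷ xs} (here refl) fx<gx = +-mono-<-≤ fx<gx (∑-mono f≤g xs)
  ∑-mono-< f≤g {xs = y ∷ xs} (there x∈)  fx<gx = +-mono-≤-< (f≤g y) (∑-mono-< f≤g x∈ fx<gx)

  ∑-max : (f : A → ℕ) (xs : List A) → 0 < length xs → ∃ λ x → x ∈ xs × ∑ f xs ≤ length xs * f x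
  ∑-max f (x ∷ [])     _ = x , here refl , ≤-refl
  ∑-max f (x ∷ y ∷ ys) _ with ∑-max f (y ∷ ys) (s≤s z≤n)
  ... | z , z∈ , ∑≤ with f x ≤? f z
  ...   | yes fx≤fz = z , there z∈ , +-mono-≤ fx≤fz ∑≤
  ...   | no  fx≰fz = x , here refl ,
          +-monoʳ-≤ (f x) (≤-trans ∑≤ (*-monoʳ-≤ (length (y ∷ ys)) (≰⇒≥ fx≰fz)))

  ∑ₜ-∈ : (F : List A → ℕ) {u : List A} {ds : List (List A)} → Pointwise _∈_ u ds → F u ≤ ∑ₜ F ds
  ∑ₜ-∈ F []               = ≤-refl
  ∑ₜ-∈ F {x ∷ u} {d ∷ ds} (x∈d ∷ u∈ds) =
    ≤-trans (∑ₜ-∈ (F ∘ (x ∷_)) u∈ds) (∑-∈ (λ y → ∑ₜ (F ∘ (y ∷_)) ds) x∈d)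

  -- Method of conditional expectations: in each block in turn, a letter is fixed whose total over
  -- the remaining blocks is at least the average.
  ∑ₜ-max : ∀ {s} .{{_ : NonZero s}} (F : List A → ℕ) ds → All (λ d → length d ≡ s) ds →
           ∃ λ u → Pointwise _∈_ u ds × ∑ₜ F ds ≤ s ^ length ds * F u
  ∑ₜ-max F [] [] = [] , [] , ≤-reflexive (sym (+-identityʳ _))
  ∑ₜ-max {s = s} F (d ∷ ds) (refl ∷ p)
    with x , x∈d , ∑≤ ← ∑-max (λ y → ∑ₜ (F ∘ (y ∷_)) ds) d (n≢0⇒n>0 (≢-nonZero⁻¹ s))
    with u , u∈ds , ∑ₜ≤ ← ∑ₜ-max (F ∘ (x ∷_)) ds p =
    x ∷ u , x∈d ∷ u∈ds ,
    ≤-trans ∑≤ (≤-trans (*-monoʳ-≤ s ∑ₜ≤) (≤-reflexive (sym (*-assoc s _ _))))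

  -- A position of a word with its letter and two candidate tie-breaking keys:
  -- along the word the first key decreases and the second increases.
  Position : Set
  Position = ℕ × ℕ × ℕ

  -- Started at `i = length xs`, as in `break-ties`, this places all low keys below `length xs` and
  -- all high keys at or above it.
  positions : ℕ → List ℕ → List Position
  positions i []       = []
  positions i (x ∷ xs) = (x , length xs , i) ∷ positions (suc i) xs

  keyed : Position → List (ℕ × ℕ)
  keyed (x , lo , hi) = (x , lo) ∷ (x , hi) ∷ []

  _before_ : Position → Position → Set
  (_ , lo , hi) before (_ , lo′ , hi′) = lo′ < lo × hi < hi′

  Within : ℕ → Position → Set
  Within N (_ , lo , hi) = lo < N × N ≤ hi × hi < N + N

  positions-bounds : ∀ i xs → All (λ (_ , lo , hi) → lo < length xs × i ≤ hi × hi < i + length xs) (positions i xs)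
  positions-bounds i []       = []
  positions-bounds i (x ∷ xs) =
    (≤-refl , ≤-refl , ≤-trans (s≤s (m≤m+n i (length xs))) (≤-reflexive (sym (+-suc i (length xs))))) ∷
    All.map (λ (lo< , i< , hi<) → m<n⇒m<1+n lo< , <⇒≤ i< , ≤-trans hi< (≤-reflexive (sym (+-suc i (length xs)))))
            (positions-bounds (suc i) xs)

  positions-before : ∀ i xs → AllPairs _before_ (positions i xs)
  positions-before i []       = []
  positions-before i (x ∷ xs) =
    All.map (λ (lo< , i< , _) → lo< , i<) (positions-bounds (suc i) xs) ∷ positions-before (suc i) xs

  letters-positions : ∀ i xs → map proj₁ (positions i xs) ≡ xs
  letters-positions i []       = refl
  letters-positions i (x ∷ xs) = cong (x ∷_) (letters-positions (suc i) xs)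

  letter-keyed : ∀ {y} e → y ∈ keyed e → proj₁ y ≡ proj₁ e
  letter-keyed e (here refl)         = refl
  letter-keyed e (there (here refl)) = refl

  letters-keyed : ∀ {u} es → Pointwise _∈_ u (map keyed es) → map proj₁ u ≡ map proj₁ es
  letters-keyed []       []           = refl
  letters-keyed (e ∷ es) (y∈e ∷ u∈es) = cong₂ _∷_ (letter-keyed e y∈e) (letters-keyed es u∈es)

  -- Positional notation in base `K`: for keys below `K`, the order of codes is lexicographic,
  -- letters first and keys second.
  code : ℕ → ℕ × ℕ → ℕ
  code K (x , key) = x * K + key

  code-mono-< : ∀ {K} x x′ key key′ → key < K → x < x′ → code K (x , key) < code K (x′ , key′)
  code-mono-< {K} x x′ key key′ key<K x<x′ = begin-strict
    x * K + key    <⟨ +-monoʳ-< (x * K) key<K ⟩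
    x * K + K      ≡⟨ +-comm (x * K) K ⟩
    suc x * K      ≤⟨ *-monoˡ-≤ K x<x′ ⟩
    x′ * K         ≤⟨ m≤m+n _ _ ⟩
    x′ * K + key′  ∎
    where open ≤-Reasoning

  code-cancel-≤ : ∀ {K} y y′ → proj₂ y < K → proj₂ y′ < K → code K y ≤ code K y′ → proj₁ y ≤ proj₁ y′
  code-cancel-≤ (x , key) (x′ , key′) _ key′<K c≤c′ =
    ≮⇒≥ (λ x′<x → <⇒≱ (code-mono-< x′ x key′ key key′<K x′<x) c≤c′)

  code-injective : ∀ {K} y y′ → proj₂ y < K → proj₂ y′ < K → code K y ≡ code K y′ → proj₂ y ≡ proj₂ y′
  code-injective {K} y@(x , key) y′@(x′ , key′) key<K key′<K c≡c′
    with refl ← ≤-antisym (code-cancel-≤ y y′ key<K key′<K (≤-reflexive c≡c′))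
                          (code-cancel-≤ y′ y key′<K key<K (≤-reflexive (sym c≡c′))) =
    +-cancelˡ-≡ (x * K) key key′ c≡c′

  key-bound : ∀ {N y} e → Within N e → y ∈ keyed e → proj₂ y < N + N
  key-bound e (lo<N , _ , _)   (here refl)         = m≤n⇒m≤n+o _ lo<N
  key-bound e (_ , _ , hi<N+N) (there (here refl)) = hi<N+N

  keys-bound : ∀ {N u} es → All (Within N) es → Pointwise _∈_ u (map keyed es) → All (λ y → proj₂ y < N + N) u
  keys-bound []       []       []           = []
  keys-bound (e ∷ es) (w ∷ ws) (y∈e ∷ u∈es) = key-bound e w y∈e ∷ keys-bound es ws u∈es

  -- Two low or two high keys differ because they are strictly monotone along the word; a low and a
  -- high key are separated by `N`.
  keys-distinct : ∀ {N y y′} e e′ → e before e′ → Within N e → Within N e′ →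
                  y ∈ keyed e → y′ ∈ keyed e′ → proj₂ y ≢ proj₂ y′
  keys-distinct e e′ (lo′<lo , _) _ _ (here refl)         (here refl)         = <⇒≢ lo′<lo ∘ sym
  keys-distinct e e′ _ (lo<N , _) (_ , N≤hi′ , _) (here refl) (there (here refl)) = <⇒≢ (<-≤-trans lo<N N≤hi′)
  keys-distinct e e′ _ (_ , N≤hi , _) (lo′<N , _) (there (here refl)) (here refl) = <⇒≢ (<-≤-trans lo′<N N≤hi) ∘ sym
  keys-distinct e e′ (_ , hi<hi′) _ _ (there (here refl)) (there (here refl)) = <⇒≢ hi<hi′

  codes-unique : ∀ {N u} es → AllPairs _before_ es → All (Within N) es → Pointwise _∈_ u (map keyed es) →
                 Unique (map (code (N + N)) u)
  codes-unique [] _ _ [] = []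
  codes-unique {N} {y ∷ _} (e ∷ es) (e<es ∷ es<) (w ∷ ws) (y∈e ∷ u∈es) =
    go es e<es ws u∈es ∷ codes-unique es es< ws u∈es
    where
    go : ∀ {u} es → All (e before_) es → All (Within N) es → Pointwise _∈_ u (map keyed es) →
         All (code (N + N) y ≢_) (map (code (N + N)) u)
    go [] _ _ [] = []
    go {y′ ∷ _} (e′ ∷ es) (e<e′ ∷ e<) (w′ ∷ ws) (y′∈ ∷ u∈) =
      keys-distinct e e′ e<e′ w w′ y∈e y′∈ ∘ code-injective y y′ (key-bound e w y∈e) (key-bound e′ w′ y′∈)
      ∷ go es e< ws u∈

  broken : ℕ → List (ℕ × ℕ) → ℕ
  broken K u = ind (monotone (map proj₁ u) ∧ not (monotone (map (code K) u)))

  <⇒≤ᵇ-false : ∀ {m n} → m < n → (n ≤ᵇ m) ≡ false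
  <⇒≤ᵇ-false {m} {n} m<n with n ≤ᵇ m in eq
  ... | false = refl
  ... | true  = contradiction (≤ᵇ⇒≤ n m (Equivalence.from T-≡ eq)) (<⇒≱ m<n)

  ≤ᵇ-true⇒≤ : ∀ {m n} → (m ≤ᵇ n) ≡ true → m ≤ n
  ≤ᵇ-true⇒≤ {m} {n} eq = ≤ᵇ⇒≤ m n (Equivalence.from T-≡ eq)

  valley-not-monotone : ∀ {a b c} u → b < a → b < c → monotone (a ∷ b ∷ c ∷ u) ≡ false
  valley-not-monotone u b<a b<c
    rewrite <⇒≤ᵇ-false b<a | <⇒≤ᵇ-false b<c | ≤⇒≤ᵇ-true (<⇒≤ b<a) = refl

  peak-not-monotone : ∀ {a b c} u → a < b → c < b → monotone (a ∷ b ∷ c ∷ u) ≡ false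
  peak-not-monotone u a<b c<b
    rewrite <⇒≤ᵇ-false a<b | <⇒≤ᵇ-false c<b | ≤⇒≤ᵇ-true (<⇒≤ a<b) = refl

  low : Position → ℕ × ℕ
  low (x , lo , _) = x , lo

  low-keyed : ∀ es → Pointwise _∈_ (map low es) (map keyed es)
  low-keyed []       = []
  low-keyed (e ∷ es) = here refl ∷ low-keyed es

  monotone-double : ∀ x u → monotone (x ∷ u) ≡ true → monotone (x ∷ x ∷ u) ≡ true
  monotone-double x u eq rewrite ≤⇒≤ᵇ-true (≤-refl {x}) = eq

  broken-one : ∀ {K} u → monotone (map proj₁ u) ≡ true → monotone (map (code K) u) ≡ false → 1 ≤ broken K u
  broken-one {K} u p q rewrite p | q = ≤-refl

  -- For x x y … non-decreasing take the keys lo lo hi, for x x y … non-increasing hi hi lo: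
  -- then the first two letters are resolved against the direction of the third.
  tie≤∑ₜ-broken : ∀ {N} es → 3 ≤ length es → AllPairs _before_ es → All (Within N) es →
                  tie (ind ∘ monotone) (map proj₁ es) ≤ ∑ₜ (broken (N + N)) (map keyed es)
  tie≤∑ₜ-broken (_ ∷ []) (s≤s ()) _ _
  tie≤∑ₜ-broken (_ ∷ _ ∷ []) (s≤s (s≤s ())) _ _
  tie≤∑ₜ-broken {N} ((x , lo₁ , hi₁) ∷ (x′ , lo₂ , hi₂) ∷ (y , lo₃ , hi₃) ∷ es) _
    (((lo₂<lo₁ , hi₁<hi₂) ∷ _) ∷ _) ((lo₁<N , N≤hi₁ , _) ∷ (lo₂<N , N≤hi₂ , _) ∷ (lo₃<N , N≤hi₃ , _) ∷ _)
    with x ≡ᵇ x′ in x≡x′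
  ... | false = z≤n
  ... | true with refl ← ≡ᵇ⇒≡ x x′ (Equivalence.from T-≡ x≡x′)
      with monotone (x ∷ y ∷ map proj₁ es) in mono-eq
  ...   | false = z≤n
  ...   | true with ≤-total x y
  ...     | inj₁ x≤y = ≤-trans (broken-one u
              (trans (cong monotone (letters-keyed ps u∈)) (monotone-double x (y ∷ map proj₁ es) mono-eq))
              (valley-not-monotone (map (code (N + N)) (map low es)) (+-monoʳ-< _ lo₂<lo₁)
                (+-mono-≤-< (*-monoˡ-≤ (N + N) x≤y) (<-≤-trans lo₂<N N≤hi₃))))
            (∑ₜ-∈ (broken (N + N)) u∈)
            where
            ps = (x , lo₁ , hi₁) ∷ (x′ , lo₂ , hi₂) ∷ (y , lo₃ , hi₃) ∷ es
            -- The high key on `y` makes the last comparison strict even when `y = x`. Three entries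
            -- already form a valley, so the keys of the remaining letters are arbitrary.
            u = (x , lo₁) ∷ (x , lo₂) ∷ (y , hi₃) ∷ map low es
            u∈ : Pointwise _∈_ u (map keyed ps)
            u∈ = here refl ∷ here refl ∷ there (here refl) ∷ low-keyed es
  ...     | inj₂ y≤x = ≤-trans (broken-one u
              (trans (cong monotone (letters-keyed ps u∈)) (monotone-double x (y ∷ map proj₁ es) mono-eq))
              (peak-not-monotone (map (code (N + N)) (map low es)) (+-monoʳ-< _ hi₁<hi₂)
                (+-mono-≤-< (*-monoˡ-≤ (N + N) y≤x) (<-≤-trans lo₃<N N≤hi₂))))
            (∑ₜ-∈ (broken (N + N)) u∈)
            where
            ps = (x , lo₁ , hi₁) ∷ (x′ , lo₂ , hi₂) ∷ (y , lo₃ , hi₃) ∷ es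
            u = (x , hi₁) ∷ (x , hi₂) ∷ (y , lo₃) ∷ map low es
            u∈ : Pointwise _∈_ u (map keyed ps)
            u∈ = there (here refl) ∷ there (here refl) ∷ here refl ∷ low-keyed es

  -- Over all key choices for the word, every key pattern on a given set of `k` positions occurs
  -- equally often, so each tied subword is broken by at least a fraction `1/2^k` of the choices.
  -- The choice `u` breaks at least the average number of subwords.
  break-ties : ∀ k → 3 ≤ k → ∀ w → let N = length w in
    ∃ λ u → map proj₁ u ≡ w × All (λ y → proj₂ y < N + N) u × Unique (map (code (N + N)) u) ×
            tied k w ≤ 2 ^ k * ∑ₛ k (broken (N + N)) u
  break-ties k 3≤k w = u , trans (letters-keyed es u∈) (letters-positions N w) ,
      keys-bound es within u∈ , codes-unique es (positions-before N w) within u∈ ,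
      *-cancelˡ-≤ (2 ^ length ds) (begin
        2 ^ length ds * tied k w
          ≡⟨ cong (λ v → 2 ^ length ds * tied k v) (letters-positions N w) ⟨
        2 ^ length ds * tied k (map proj₁ es)
          ≡⟨ cong (2 ^ length ds *_) (∑ₛ-map k (tie (ind ∘ monotone)) proj₁ es) ⟩
        2 ^ length ds * ∑ₛ k (tie (ind ∘ monotone) ∘ map proj₁) es
          ≤⟨ *-monoʳ-≤ (2 ^ length ds) (∑ₛ-mono k es (λ v |v| τ → tie≤∑ₜ-broken v (≤-trans 3≤k (≤-reflexive (sym |v|)))
               (AllPairs-resp-⊆ τ (positions-before N w)) (All-resp-⊆ τ within))) ⟩
        2 ^ length ds * ∑ₛ k (∑ₜ (broken (N + N)) ∘ map keyed) es
          ≡⟨ cong (2 ^ length ds *_) (∑ₛ-map k (∑ₜ (broken (N + N))) keyed es) ⟨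
        2 ^ length ds * ∑ₛ k (∑ₜ (broken (N + N))) ds
          ≡⟨ ∑ₜ-∑ₛ k (broken (N + N)) ds |d| ⟨
        2 ^ k * ∑ₜ (∑ₛ k (broken (N + N))) ds
          ≤⟨ *-monoʳ-≤ (2 ^ k) ∑ₜ≤ ⟩
        2 ^ k * (2 ^ length ds * ∑ₛ k (broken (N + N)) u)
          ≡⟨ a*bc≡b*ac (2 ^ k) (2 ^ length ds) _ ⟩
        2 ^ length ds * (2 ^ k * ∑ₛ k (broken (N + N)) u) ∎)
    where
    open ≤-Reasoning
    N = length w
    es = positions N w
    ds = map keyed es
    instance _ = m^n≢0 2 (length ds)
    within : All (Within N) es
    within = positions-bounds N w
    |d| : All (λ d → length d ≡ 2) ds
    |d| = map⁺ (All.universal (λ _ → refl) es)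
    best = ∑ₜ-max (∑ₛ k (broken (N + N))) ds |d|
    u = proj₁ best
    u∈ = proj₁ (proj₂ best)
    ∑ₜ≤ = proj₂ (proj₂ best)

  -- Ranks and coarsening of orders.

  rank : List ℕ → ℕ → ℕ
  rank z x = ∑ (λ y → ind (y <ᵇ x)) z

  ind-<ᵇ-true : ∀ {m n} → m < n → ind (m <ᵇ n) ≡ 1
  ind-<ᵇ-true m<n = cong ind (T⇒≡true (<⇒<ᵇ m<n))

  ind-<ᵇ-irrefl : ∀ n → ind (n <ᵇ n) ≡ 0
  ind-<ᵇ-irrefl zero    = refl
  ind-<ᵇ-irrefl (suc n) = ind-<ᵇ-irrefl n

  ind≤1 : ∀ b → ind b ≤ 1
  ind≤1 true  = ≤-refl
  ind≤1 false = z≤n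

  -- The inequality is strict because `x` itself is counted below `y` but not below `x`.
  rank-mono-< : ∀ {z x y} → x ∈ z → x < y → rank z x < rank z y
  rank-mono-< {z} {x} {y} x∈z x<y = ∑-mono-< le x∈z
    (≤-reflexive (trans (cong suc (ind-<ᵇ-irrefl x)) (sym (ind-<ᵇ-true x<y))))
    where
    le : ∀ a → ind (a <ᵇ x) ≤ ind (a <ᵇ y)
    le a with a <ᵇ x in eq
    ... | false = z≤n
    ... | true  = ≤-reflexive (sym (ind-<ᵇ-true (<-trans (<ᵇ⇒< a x (Equivalence.from T-≡ eq)) x<y)))

  rank-cancel-≤ : ∀ {z x y} → x ∈ z → y ∈ z → rank z x ≤ rank z y → x ≤ y
  rank-cancel-≤ _ y∈z r≤r′ = ≮⇒≥ (λ y<x → <⇒≱ (rank-mono-< y∈z y<x) r≤r′)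

  rank-injective : ∀ {z x y} → x ∈ z → y ∈ z → rank z x ≡ rank z y → x ≡ y
  rank-injective x∈z y∈z eq =
    ≤-antisym (rank-cancel-≤ x∈z y∈z (≤-reflexive eq)) (rank-cancel-≤ y∈z x∈z (≤-reflexive (sym eq)))

  rank-bound : ∀ {z x} → x ∈ z → rank z x < length z
  rank-bound {z} {x} x∈z = ≤-trans
    (∑-mono-< {g = λ _ → 1} (λ y → ind≤1 (y <ᵇ x)) x∈z (s≤s (≤-reflexive (ind-<ᵇ-irrefl x))))
    (≤-reflexive (trans (∑-const 1 z) (*-identityʳ _)))

  module _ {P : A → Set} {h h′ : A → ℕ} (refine : ∀ {a b} → P a → P b → h a ≤ h b → h′ a ≤ h′ b) where

    nondecreasing-coarsen : ∀ {u} → All P u → nondecreasing (map h u) ≡ true → nondecreasing (map h′ u) ≡ true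
    nondecreasing-coarsen []       _ = refl
    nondecreasing-coarsen (_ ∷ []) _ = refl
    nondecreasing-coarsen {a ∷ b ∷ _} (pa ∷ ps@(pb ∷ _)) eq =
      cong₂ _∧_ (≤⇒≤ᵇ-true (refine pa pb (≤ᵇ-true⇒≤ (∧-conicalˡ _ _ eq))))
                (nondecreasing-coarsen ps (∧-conicalʳ (h a ≤ᵇ h b) _ eq))

    nonincreasing-coarsen : ∀ {u} → All P u → nonincreasing (map h u) ≡ true → nonincreasing (map h′ u) ≡ true
    nonincreasing-coarsen []       _ = refl
    nonincreasing-coarsen (_ ∷ []) _ = refl
    nonincreasing-coarsen {a ∷ b ∷ _} (pa ∷ ps@(pb ∷ _)) eq =
      cong₂ _∧_ (≤⇒≤ᵇ-true (refine pb pa (≤ᵇ-true⇒≤ (∧-conicalˡ _ _ eq))))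
                (nonincreasing-coarsen ps (∧-conicalʳ (h b ≤ᵇ h a) _ eq))

    -- Applied from ranks to codes and again from codes to letters, this shows that breaking ties
    -- creates no new monotone subwords.
    monotone-coarsen : ∀ {u} → All P u → monotone (map h u) ≡ true → monotone (map h′ u) ≡ true
    monotone-coarsen {u} ps eq with nondecreasing (map h u) in nd
    ... | true  = cong (_∨ nonincreasing (map h′ u)) (nondecreasing-coarsen ps nd)
    ... | false = trans (cong (nondecreasing (map h′ u) ∨_) (nonincreasing-coarsen ps eq)) (∨-zeroʳ _)

  -- Monotone counts, lists of permutations and standardisation.

  length-filterᵇ-map : ∀ (p : B → Bool) (h : A → B) xs →
                       length (filterᵇ p (map h xs)) ≡ length (filterᵇ (p ∘ h) xs)
  length-filterᵇ-map p h []       = refl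
  length-filterᵇ-map p h (x ∷ xs) with p (h x)
  ... | true  = cong suc (length-filterᵇ-map p h xs)
  ... | false = length-filterᵇ-map p h xs

  length-filterᵇ-choose : ∀ k (p : List A → Bool) xs → length (filterᵇ p (choose k xs)) ≡ ∑ₛ k (ind ∘ p) xs
  length-filterᵇ-choose zero p xs with p []
  ... | true  = refl
  ... | false = refl
  length-filterᵇ-choose (suc k) p []       = refl
  length-filterᵇ-choose (suc k) p (x ∷ xs) = begin
    length (filterᵇ p (map (x ∷_) (choose k xs) ++ choose (suc k) xs))
      ≡⟨ cong length (filter-++ (T? ∘ p) (map (x ∷_) (choose k xs)) _) ⟩
    length (filterᵇ p (map (x ∷_) (choose k xs)) ++ filterᵇ p (choose (suc k) xs))
      ≡⟨ length-++ (filterᵇ p (map (x ∷_) (choose k xs))) ⟩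
    length (filterᵇ p (map (x ∷_) (choose k xs))) + length (filterᵇ p (choose (suc k) xs))
      ≡⟨ cong₂ _+_ (trans (length-filterᵇ-map p (x ∷_) (choose k xs)) (length-filterᵇ-choose k (p ∘ (x ∷_)) xs))
                   (length-filterᵇ-choose (suc k) p xs) ⟩
    ∑ₛ k (ind ∘ p ∘ (x ∷_)) xs + ∑ₛ (suc k) (ind ∘ p) xs ∎
    where open ≡-Reasoning

  mono-∑ₛ : ∀ k w → mono k w ≡ ∑ₛ k (ind ∘ monotone) w
  mono-∑ₛ k = length-filterᵇ-choose k monotone

  Unique-map : {P : A → Set} {h : A → B} → (∀ {a b} → P a → P b → h a ≡ h b → a ≡ b) →
               ∀ {xs} → All P xs → Unique xs → Unique (map h xs)
  Unique-map inj []       []         = []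
  Unique-map {P = P} {h} inj {x ∷ _} (px ∷ ps) (x≢ ∷ u) = go ps x≢ ∷ Unique-map inj ps u
    where
    go : ∀ {ys} → All P ys → All (x ≢_) ys → All (h x ≢_) (map h ys)
    go []       []        = []
    go (p ∷ ps) (x≢y ∷ q) = x≢y ∘ inj px p ∷ go ps q

  notIn⁺ : ∀ {x ys} → All (x ≢_) ys → notIn x ys ≡ true
  notIn⁺ []                  = refl
  notIn⁺ {x} {y ∷ _} (x≢y ∷ p) with x ≡ᵇ y in eq
  ... | false = notIn⁺ p
  ... | true  = contradiction (≡ᵇ⇒≡ x y (Equivalence.from T-≡ eq)) x≢y

  distinct⁺ : ∀ {xs} → Unique xs → distinct xs ≡ true
  distinct⁺ []      = refl
  distinct⁺ (p ∷ u) = cong₂ _∧_ (notIn⁺ p) (distinct⁺ u)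

  ∈-allWords : ∀ {s} (w : List (Fin s)) → w ∈ allWords s (length w)
  ∈-allWords []      = here refl
  ∈-allWords (x ∷ w) = ∈-concatMap⁺ (λ a → map (a ∷_) (allWords _ (length w)))
    (Any.map (λ { refl → ∈-map⁺ (x ∷_) (∈-allWords w) }) (∈-allFin x))

  fromℕs : ∀ {s xs} → All (_< s) xs → ∃ λ (fs : List (Fin s)) → toℕs fs ≡ xs × length fs ≡ length xs
  fromℕs []       = [] , refl , refl
  fromℕs (p ∷ ps) with fs , eq , len ← fromℕs ps = fromℕ< p ∷ fs , cong₂ _∷_ (toℕ-fromℕ< p) eq , cong suc len

  ∈-perms : ∀ {xs} → All (_< length xs) xs → Unique xs → xs ∈ perms (length xs)
  ∈-perms {xs} xs< u with fs , eq , len ← fromℕs xs< =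
    ∈-filter⁺ (T? ∘ distinct)
      (subst₂ (λ ys n → ys ∈ map toℕs (allWords (length xs) n)) eq len (∈-map⁺ toℕs (∈-allWords fs)))
      (Equivalence.from T-≡ (distinct⁺ u))

  ind-∧ : ∀ a b → ind (a ∧ b) ≤ ind a
  ind-∧ true  b = ind≤1 b
  ind-∧ false b = z≤n

  -- The permutation consists of the ranks of the codes from `break-ties`. The factor `2 ^ k` is the
  -- price of averaging over key patterns.
  standardise : ∀ k → 3 ≤ k → ∀ w →
    ∃ λ π → π ∈ perms (length w) × tied k w + 2 ^ k * mono k π ≤ 2 ^ k * mono k w
  standardise k 3≤k w with u , refl , keys< , unique , tied≤ ← break-ties k 3≤k w =
    π , subst (λ n → π ∈ perms n) |π| (∈-perms π< (Unique-map rank-injective self unique)) , (begin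
      tied k (map proj₁ u) + 2 ^ k * mono k π
        ≤⟨ +-monoˡ-≤ _ tied≤ ⟩
      2 ^ k * ∑ₛ k (broken K) u + 2 ^ k * mono k π
        ≡⟨ *-distribˡ-+ (2 ^ k) _ _ ⟨
      2 ^ k * (∑ₛ k (broken K) u + mono k π)
        ≡⟨ cong (λ c → 2 ^ k * (∑ₛ k (broken K) u + c))
             (trans (mono-∑ₛ k π) (trans (∑ₛ-map k _ (rank z) z) (∑ₛ-map k _ (code K) u))) ⟩
      2 ^ k * (∑ₛ k (broken K) u + ∑ₛ k (λ v → ind (monotone (map (rank z) (map (code K) v)))) u)
        ≡⟨ cong (2 ^ k *_) (∑ₛ-+ k (broken K) _ u) ⟨
      2 ^ k * ∑ₛ k (λ v → broken K v + ind (monotone (map (rank z) (map (code K) v)))) u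
        ≤⟨ *-monoʳ-≤ (2 ^ k) (∑ₛ-mono k u (λ v _ τ → pointwise v (All-resp-⊆ τ keys<) (All-resp-⊆ τ members))) ⟩
      2 ^ k * ∑ₛ k (ind ∘ monotone ∘ map proj₁) u
        ≡⟨ cong (2 ^ k *_) (trans (mono-∑ₛ k (map proj₁ u)) (∑ₛ-map k _ proj₁ u)) ⟨
      2 ^ k * mono k (map proj₁ u) ∎)
    where
    open ≤-Reasoning
    K = length (map proj₁ u) + length (map proj₁ u)
    z = map (code K) u
    π = map (rank z) z
    self : All (_∈ z) z
    self = All.tabulate id
    members : All (λ y → code K y ∈ z) u
    members = All.tabulate (∈-map⁺ (code K))
    |π|≡|z| : length π ≡ length z
    |π|≡|z| = length-map (rank z) z
    |π| : length π ≡ length (map proj₁ u)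
    |π| = trans |π|≡|z| (trans (length-map (code K) u) (sym (length-map proj₁ u)))
    π< : All (_< length π) π
    π< = map⁺ (All.map (λ x∈z → ≤-trans (rank-bound x∈z) (≤-reflexive (sym |π|≡|z|))) self)
    -- A subword monotone in ranks is monotone in codes, hence not broken: the two indicators on the
    -- left are never both 1, and either one forces monotone letters.
    pointwise : ∀ v → All (λ y → proj₂ y < K) v → All (λ y → code K y ∈ z) v →
      broken K v + ind (monotone (map (rank z) (map (code K) v))) ≤ ind (monotone (map proj₁ v))
    pointwise v v<K v∈ with monotone (map (rank z) (map (code K) v)) in eq
    ... | false = ≤-trans (≤-reflexive (+-identityʳ _)) (ind-∧ (monotone (map proj₁ v)) _)
    ... | true
      with codes ← monotone-coarsen {h = rank z ∘ code K} {h′ = code K} rank-cancel-≤ v∈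
                     (trans (cong monotone (map-∘ v)) eq)
      with letters ← monotone-coarsen {h = code K} {h′ = proj₁} (λ {y} {y′} → code-cancel-≤ y y′) v<K codes
      rewrite codes | letters = ≤-refl

-- Minima and densities as rational numbers.

open Counting
open import Data.Integer as ℤ using (+_)
import Data.Integer.Properties as ℤ
open import Data.Rational using (ℚ; 0ℚ; _<_; _+_; _*_; _-_; toℚᵘ) renaming (_≤_ to _≤ℚ_)
open import Data.Rational.Properties as ℚ using (toℚᵘ-fromℚᵘ; toℚᵘ-homo-+; toℚᵘ-homo-*; toℚᵘ-cancel-≤)
open import Data.Rational.Unnormalised as ℚᵘ using (mkℚᵘ; *≤*)
import Data.Rational.Unnormalised.Properties as ℚᵘ

-- The member `q` only certifies that the list is non-empty, which rules out the default value 0 of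
-- `minList`.
minList-glb : ∀ {p q xs} → q ∈ xs → All (p ≤ℚ_) xs → p ≤ℚ minList xs
minList-glb {xs = _ ∷ []}     _ (p≤x ∷ []) = p≤x
minList-glb {xs = x ∷ y ∷ ys} _ (p≤x ∷ ps) = ℚ.⊓-glb p≤x (minList-glb (here refl) ps)

minList-≤ : ∀ {q xs} → q ∈ xs → minList xs ≤ℚ q
minList-≤ {xs = _ ∷ []}     (here refl) = ℚ.≤-refl
minList-≤ {xs = x ∷ y ∷ ys} (here refl) = ℚ.p⊓q≤p x _
minList-≤ {xs = x ∷ y ∷ ys} (there q∈)  = ℚ.≤-trans (ℚ.p⊓q≤q x _) (minList-≤ q∈)

length-allWords : ∀ s n → All (λ w → length w ≡ n) (allWords s n)
length-allWords s zero    = refl ∷ []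
length-allWords s (suc n) =
  concat⁺ (map⁺ {f = λ a → map (a ∷_) (allWords s n)}
    (All.universal (λ a → map⁺ {f = a ∷_} (All.map (cong suc) (length-allWords s n))) (allFin s)))

-- The natural-number hypothesis is the rational inequality with the denominators `c`, `e` and `s`
-- cleared.
ratio-+-inv : ∀ p q c e s .{{_ : NonZero c}} .{{_ : NonZero e}} .{{_ : NonZero s}} →
              c ℕ.+ s ℕ.* e ℕ.* p ≤ s ℕ.* e ℕ.* q → ratio p c + inv e * inv s ≤ℚ ratio q c
ratio-+-inv p q c@(suc c-1) e@(suc e-1) s@(suc s-1) le = toℚᵘ-cancel-≤ (begin
  toℚᵘ (ratio p c + inv e * inv s)
    ≃⟨ toℚᵘ-homo-+ (ratio p c) (inv e * inv s) ⟩
  toℚᵘ (ratio p c) ℚᵘ.+ toℚᵘ (inv e * inv s)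
    ≃⟨ ℚᵘ.+-cong (toℚᵘ-fromℚᵘ (mkℚᵘ (+ p) c-1)) (ℚᵘ.≃-trans (toℚᵘ-homo-* (inv e) (inv s))
         (ℚᵘ.*-cong (toℚᵘ-fromℚᵘ (mkℚᵘ (+ 1) e-1)) (toℚᵘ-fromℚᵘ (mkℚᵘ (+ 1) s-1)))) ⟩
  mkℚᵘ (+ p) c-1 ℚᵘ.+ mkℚᵘ (+ 1) e-1 ℚᵘ.* mkℚᵘ (+ 1) s-1
    ≤⟨ *≤* cross ⟩
  mkℚᵘ (+ q) c-1
    ≃⟨ toℚᵘ-fromℚᵘ (mkℚᵘ (+ q) c-1) ⟨
  toℚᵘ (ratio q c) ∎)
  where
  open ℚᵘ.≤-Reasoning
  lhs : ∀ p c e s → (p ℕ.* (e ℕ.* s) ℕ.+ 1 ℕ.* c) ℕ.* c ≡ c ℕ.* (c ℕ.+ s ℕ.* e ℕ.* p)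
  lhs = solve-∀
  rhs : ∀ q c e s → c ℕ.* (s ℕ.* e ℕ.* q) ≡ q ℕ.* (c ℕ.* (e ℕ.* s))
  rhs = solve-∀
  natural : (p ℕ.* (e ℕ.* s) ℕ.+ 1 ℕ.* c) ℕ.* c ≤ q ℕ.* (c ℕ.* (e ℕ.* s))
  natural = ℕ.≤-trans (ℕ.≤-reflexive (lhs p c e s))
    (ℕ.≤-trans (ℕ.*-monoʳ-≤ c le) (ℕ.≤-reflexive (rhs q c e s)))
  cross : (+ p ℤ.* + (e ℕ.* s) ℤ.+ + 1 ℤ.* + c) ℤ.* + c ℤ.≤ + q ℤ.* + (c ℕ.* (e ℕ.* s))
  cross = subst₂ ℤ._≤_
    (trans (ℤ.pos-* (p ℕ.* (e ℕ.* s) ℕ.+ 1 ℕ.* c) c)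
      (cong (ℤ._* + c) (cong₂ ℤ._+_ (ℤ.pos-* p (e ℕ.* s)) (ℤ.pos-* 1 c))))
    (ℤ.pos-* q (c ℕ.* (e ℕ.* s)))
    (ℤ.+≤+ natural)

-- Eliminates the number `t` of tied subwords between `tied-lower` and `standardise`.
combine : ∀ s b c {t p q x} → x ≤ s ℕ.* b ℕ.* t → t ℕ.+ c ℕ.* p ≤ c ℕ.* q →
          x ℕ.+ s ℕ.* (b ℕ.* c) ℕ.* p ≤ s ℕ.* (b ℕ.* c) ℕ.* q
combine s b c {t} {p} {q} {x} x≤ le = begin
  x ℕ.+ s ℕ.* (b ℕ.* c) ℕ.* p                ≤⟨ ℕ.+-monoˡ-≤ _ x≤ ⟩
  s ℕ.* b ℕ.* t ℕ.+ s ℕ.* (b ℕ.* c) ℕ.* p    ≡⟨ collect s b c t p ⟩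
  s ℕ.* b ℕ.* (t ℕ.+ c ℕ.* p)                ≤⟨ ℕ.*-monoʳ-≤ (s ℕ.* b) le ⟩
  s ℕ.* b ℕ.* (c ℕ.* q)                      ≡⟨ reassoc s b c q ⟩
  s ℕ.* (b ℕ.* c) ℕ.* q                      ∎
  where
  open ℕ.≤-Reasoning
  collect : ∀ s b c t p → s ℕ.* b ℕ.* t ℕ.+ s ℕ.* (b ℕ.* c) ℕ.* p ≡ s ℕ.* b ℕ.* (t ℕ.+ c ℕ.* p)
  collect = solve-∀
  reassoc : ∀ s b c p → s ℕ.* b ℕ.* (c ℕ.* p) ≡ s ℕ.* (b ℕ.* c) ℕ.* p
  reassoc = solve-∀

-- The gap between words and permutations.

-- Division-free form of a density gap `1/(s e)`, for words longer than a threshold that may depend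
-- on `s`. The clause `k ≤ length w` keeps the binomial denominator non-zero.
Gap : ℕ → ℕ → Set
Gap k e = ∀ s .{{_ : NonZero s}} → ∃ λ m → ∀ w → All (ℕ._< s) w → m ≤ length w →
  k ≤ length w × ∃ λ π → π ∈ perms (length w) ×
    length w C k ℕ.+ s ℕ.* e ℕ.* mono k π ≤ s ℕ.* e ℕ.* mono k w

gap : ∀ k → 3 ≤ k → ∃ λ e → NonZero e × Gap k e
gap (suc zero)    (s≤s ())
-- Here `b` is the loss from `tied-lower` and `2 ^ k` the loss from `standardise`; their product is
-- `(4M)^k`. The threshold below is the length `2sM` of one sampled subword.
gap (suc (suc j)) 3≤k = b ℕ.* 2 ℕ.^ k , ℕ.m*n≢0 b (2 ℕ.^ k) , λ s →
  M ℕ.* (s ℕ.+ s) , λ w w<s m≤n →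
    let π , π∈ , le = standardise k 3≤k w
    in ℕ.≤-trans (k≤2^[k+k]*[s+s] j s) m≤n , π , π∈ ,
       combine s b (2 ℕ.^ k) (tied-lower j s w w<s m≤n) le
  where
  k = 2 ℕ.+ j
  M = 2 ℕ.^ (suc j ℕ.+ suc j)
  b = (2 ℕ.* M) ℕ.^ k
  instance
    2^k≢0 = ℕ.m^n≢0 2 k
    b≢0 = ℕ.m^n≢0 (2 ℕ.* M) k {{ℕ.m*n≢0 2 M {{_}} {{ℕ.m^n≢0 2 (suc j ℕ.+ suc j)}}}}

inv>0 : ∀ n .{{_ : NonZero n}} → 0ℚ < inv n
inv>0 (suc n) = ℚ.positive⁻¹ (inv (suc n)) {{ℚ.normalize-pos 1 (suc n)}}

-- The gap holds exactly for every sufficiently large `n`, so the error `ε` is simply discarded.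
p-ε≤p : ∀ p {ε} → 0ℚ < ε → p - ε ≤ℚ p
p-ε≤p p {ε} 0<ε = ℚ.≤-trans (ℚ.+-monoʳ-≤ p (ℚ.<⇒≤ (ℚ.neg-antimono-< 0<ε))) (ℚ.≤-reflexive (ℚ.+-identityʳ p))

theorem5p1 : ∀ (k : ℕ) → 3 ≤ k →
    Σ ℚ (λ c → (0ℚ < c) ×
    (∀ (s : ℕ) → 1 ≤ s → ∀ (ε : ℚ) → 0ℚ < ε →
    Σ ℕ (λ N → ∀ (n : ℕ) → N ≤ n →
    ((g k n + c * inv s) - ε) ≤ℚ f s k n)))
theorem5p1 k 3≤k with e , e≢0 , gaps ← gap k 3≤k = inv e , inv>0 e {{e≢0}} , bound
  where
  bound : ∀ s → 1 ≤ s → ∀ ε → 0ℚ < ε → Σ ℕ (λ N → ∀ n → N ≤ n → ((g k n + inv e * inv s) - ε) ≤ℚ f s k n)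
  bound s@(suc _) _ ε 0<ε with N , gap-at ← gaps s = N , λ n N≤n →
    minList-glb
      -- The all-zero word shows that the list of words is non-empty; it exists because `s` is
      -- positive.
      (∈-map⁺ _ (subst (λ l → replicate n zero ∈ allWords s l) (length-replicate n) (∈-allWords (replicate n zero))))
      (map⁺ (All.map (λ {w} |w| → word-bound n N≤n w |w|) (length-allWords s n)))
    where
    word-bound : ∀ n → N ≤ n → (w : List (Fin s)) → length w ≡ n →
                 ((g k n + inv e * inv s) - ε) ≤ℚ ratio (mono k (toℕs w)) (n C k)
    word-bound n N≤n w |w| with trans (length-map toℕ w) |w|
    ... | refl with k≤n , π , π∈ , le ← gap-at (toℕs w) (map⁺ (All.universal toℕ<n w)) N≤n = begin
        (g k n + inv e * inv s) - ε
          ≤⟨ p-ε≤p _ 0<ε ⟩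
        g k n + inv e * inv s
          ≤⟨ ℚ.+-monoˡ-≤ (inv e * inv s) (minList-≤ (∈-map⁺ (λ ρ → ratio (mono k ρ) (n C k)) π∈)) ⟩
        ratio (mono k π) (n C k) + inv e * inv s
          ≤⟨ ratio-+-inv (mono k π) (mono k (toℕs w)) (n C k) e s {{>-nonZero (nCk>0 k≤n)}} {{e≢0}} le ⟩
        ratio (mono k (toℕs w)) (n C k) ∎
        where open ℚ.≤-Reasoning
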